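{- In a non-degenerate RiFle assignment game, the set of all stable outcomes is a lattice under the partial order $\ge_P$ of $P$-preferences.
   Context: A RiFle assignment game consists of two disjoint sets of agents $P=\{p_1,\dots,p_n\}$ and $Q=\{q_1,\dots,q_n\}$, a pair of nonnegative real numbers $(\beta_{ij},\gamma_{ij})$ for every pair $(p_i,q_j)\in P\times Q$ (write $\alpha_{ij}=\beta_{ij}+\gamma_{ij}$), and a designation of every agent as rigid or flexible. Let $\mathcal R$ be the set of pairs with at least one rigid agent and $\mathcal F$ the set of pairs with both agents flexible. An outcome $(\bar u,\bar v;\mu)$ consists of a matching $\mu$ between $P$ and $Q$ (write $p_i\stackrel{\mu}{\longleftrightarrow} q_j$) and payoff vectors $\bar u,\bar v\in\mathbb R^n$. It is feasible if: (1) $u_i\ge0$, $v_j\ge0$; (2) if a rigid $p_i$ is matched to $q_j$ then $u_i=\beta_{ij}$ and, if $q_j$ is flexible, $v_j\ge\gamma_{ij}$; symmetrically for a rigid $q_j$ matched to $p_i$: $v_j=\gamma_{ij}$ and, if $p_i$ is flexible, $u_i\ge\beta_{ij}$; (3) $\sum_iu_i+\sum_jv_j=\sum_{p_i\stackrel{\mu}{\longleftrightarrow}q_j}\alpha_{ij}$. It is stable if feasible and $u_i+v_j\ge\alpha_{ij}$ for $(p_i,q_j)\in\mathcal F$ and ($u_i\ge\beta_{ij}$ or $v_j\ge\gamma_{ij}$) for $(p_i,q_j)\in\mathcal R$. Reservation prices are modeled by rigid dummy agents; for the following definition an agent left unmatched by a matching is regarded as matched to a rigid dummy agent (whose prescribed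 share $\beta$ or $\gamma$ for him is his reservation price). Given a coalition $C\subseteq P\cup Q$ and a matching $\mu$, the total payoff to $C$ under $\mu$ is forced if every pair matched under $\mu$ with one agent in $C$ and the other outside $C$ is rigid (contains a rigid agent); the forced payoff is then $\sum_{p_i\in C,\ p_i\stackrel{\mu}{\longleftrightarrow}q_j}\beta_{ij}+\sum_{q_j\in C,\ p_i\stackrel{\mu}{\longleftrightarrow}q_j}\gamma_{ij}$. The game is non-degenerate if for any two matchings $\mu,\mu'$: whenever $C$ is a minimal coalition such that the payoff to $C$ is forced under both $\mu$ and $\mu'$, and the two forced payoffs are equal, then $\mu$ and $\mu'$ coincide on $C$. For outcomes, $(\bar u,\bar v;\mu)\ge_P(\bar u',\bar v';\mu')$ means $\bar u\ge\bar u'$ and $\bar v\le\bar v'$ componentwise. -}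

module Defs where

open import Data.Bool using (if_then_else_)
open import Data.Fin using (Fin)
open import Data.Fin.Subset using (Subset; _∈_; _∉_; _⊆_; Nonempty)
open import Data.Maybe using (Maybe; just; maybe′)
open import Data.Nat as ℕ using (ℕ)
import Data.Nat.Properties as ℕ
open import Data.Product using (Σ; ∃; _×_; _,_)
open import Data.Rational as ℚ using (ℚ; 0ℚ; ½)
import Data.Rational.Properties as ℚ
open import Data.Sum using (_⊎_)
import Data.Vec as Vec
open import Data.Vec.Functional using (Vector; foldr)
open import Relation.Binary.PropositionalEquality
  using (_≡_; sym; trans; cong; subst)

-- The real numbers: Cauchy sequences of rationals, compared through their
-- limits by the setoid equality _≈_ and the order _≤_.  Only the ordered
-- additive structure is needed.

IsCauchy : (ℕ → ℚ) → Set
IsCauchy x = ∀ ε → 0ℚ ℚ.< ε →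
  ∃ λ N → ∀ m n → N ℕ.≤ m → N ℕ.≤ n → ℚ.∣ x m ℚ.- x n ∣ ℚ.< ε

record ℝ : Set where
  constructor mkℝ
  field
    seq    : ℕ → ℚ
    cauchy : IsCauchy seq
open ℝ public

infix  4 _≈_ _≤_
infixl 6 _+_

_≈_ : ℝ → ℝ → Set
x ≈ y = ∀ ε → 0ℚ ℚ.< ε →
  ∃ λ N → ∀ n → N ℕ.≤ n → ℚ.∣ seq x n ℚ.- seq y n ∣ ℚ.< ε

_≤_ : ℝ → ℝ → Set
x ≤ y = ∀ ε → 0ℚ ℚ.< ε →
  ∃ λ N → ∀ n → N ℕ.≤ n → seq x n ℚ.< seq y n ℚ.+ ε

0ℝ : ℝ
0ℝ = mkℝ (λ _ → 0ℚ) λ _ ε>0 → 0 , λ _ _ _ _ → ε>0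

half-positive : ∀ {ε} → 0ℚ ℚ.< ε → 0ℚ ℚ.< ½ ℚ.* ε
half-positive {ε} ε>0 =
  subst (ℚ._< ½ ℚ.* ε) (ℚ.*-zeroʳ ½) (ℚ.*-monoʳ-<-pos ½ ε>0)

half+half : ∀ ε → ½ ℚ.* ε ℚ.+ ½ ℚ.* ε ≡ ε
half+half ε = trans (sym (ℚ.*-distribʳ-+ ε ½ ½)) (ℚ.*-identityˡ ε)

sub-interchange : ∀ a b c d →
  (a ℚ.+ b) ℚ.- (c ℚ.+ d) ≡ (a ℚ.- c) ℚ.+ (b ℚ.- d)
sub-interchange a b c d =
  trans (cong (a ℚ.+ b ℚ.+_) (ℚ.neg-distrib-+ c d))
  (trans (ℚ.+-assoc a b _)
  (trans (cong (a ℚ.+_)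
    (trans (sym (ℚ.+-assoc b (ℚ.- c) (ℚ.- d)))
    (trans (cong (ℚ._- d) (ℚ.+-comm b (ℚ.- c)))
           (ℚ.+-assoc (ℚ.- c) b (ℚ.- d)))))
  (sym (ℚ.+-assoc a (ℚ.- c) _))))

+-cauchy : ∀ {x y} → IsCauchy x → IsCauchy y → IsCauchy (λ n → x n ℚ.+ y n)
+-cauchy {x} {y} cx cy ε ε>0
  with cx (½ ℚ.* ε) (half-positive ε>0) | cy (½ ℚ.* ε) (half-positive ε>0)
... | M , hx | N , hy = M ℕ.⊔ N , λ m n m≥ n≥ →
  subst (ℚ._< ε)
    (cong ℚ.∣_∣ (sym (sub-interchange (x m) (y m) (x n) (y n))))
    (ℚ.≤-<-trans (ℚ.∣p+q∣≤∣p∣+∣q∣ (x m ℚ.- x n) (y m ℚ.- y n))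
      (subst (_ ℚ.<_) (half+half ε)
        (ℚ.+-mono-<
          (hx m n (ℕ.≤-trans (ℕ.m≤m⊔n M N) m≥) (ℕ.≤-trans (ℕ.m≤m⊔n M N) n≥))
          (hy m n (ℕ.≤-trans (ℕ.m≤n⊔m M N) m≥) (ℕ.≤-trans (ℕ.m≤n⊔m M N) n≥)))))

_+_ : ℝ → ℝ → ℝ
x + y = mkℝ (λ n → seq x n ℚ.+ seq y n)
            (+-cauchy {seq x} {seq y} (cauchy x) (cauchy y))

sum : ∀ {n} → Vector ℝ n → ℝ
sum = foldr _+_ 0ℝ

data Kind : Set where
  rigid flexible : Kind

record Game (n : ℕ) : Set where
  field
    β γ         : Fin n → Fin n → ℝ
    β-nonneg    : ∀ i j → 0ℝ ≤ β i j
    γ-nonneg    : ∀ i j → 0ℝ ≤ γ i j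
    kindP kindQ : Fin n → Kind

  α : Fin n → Fin n → ℝ
  α i j = β i j + γ i j

  RigidPair : Fin n → Fin n → Set
  RigidPair i j = kindP i ≡ rigid ⊎ kindQ j ≡ rigid

  FlexiblePair : Fin n → Fin n → Set
  FlexiblePair i j = kindP i ≡ flexible × kindQ j ≡ flexible

-- A matching may leave agents unmatched; it is given by the two mutually
-- inverse partial functions sending an agent to its partner.

record Matching (n : ℕ) : Set where
  field
    partnerP : Fin n → Maybe (Fin n)
    partnerQ : Fin n → Maybe (Fin n)
    P⇒Q      : ∀ {i j} → partnerP i ≡ just j → partnerQ j ≡ just i
    Q⇒P      : ∀ {i j} → partnerQ j ≡ just i → partnerP i ≡ just j
open Matching public

infix 4 _⟷[_]_

_⟷[_]_ : ∀ {n} → Fin n → Matching n → Fin n → Set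
i ⟷[ μ ] j = partnerP μ i ≡ just j

record Outcome (n : ℕ) : Set where
  field
    u : Vector ℝ n
    v : Vector ℝ n
    μ : Matching n
open Outcome public

record Coalition (n : ℕ) : Set where
  field
    inP : Subset n
    inQ : Subset n
open Coalition public

infix 4 _⊆ᶜ_

_⊆ᶜ_ : ∀ {n} → Coalition n → Coalition n → Set
C ⊆ᶜ D = inP C ⊆ inP D × inQ C ⊆ inQ D

NonemptyCoalition : ∀ {n} → Coalition n → Set
NonemptyCoalition C = Nonempty (inP C) ⊎ Nonempty (inQ C)

CoincideOn : ∀ {n} → Coalition n → Matching n → Matching n → Set
CoincideOn C μ μ′ =
    (∀ i → i ∈ inP C → partnerP μ i ≡ partnerP μ′ i)
  × (∀ j → j ∈ inQ C → partnerQ μ j ≡ partnerQ μ′ j)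

module _ {n : ℕ} (G : Game n) where
  open Game G

  totalShare : Matching n → ℝ
  totalShare μ = sum λ i → maybe′ (λ j → α i j) 0ℝ (partnerP μ i)

  record Feasible (o : Outcome n) : Set where
    field
      u-nonneg : ∀ i → 0ℝ ≤ u o i
      v-nonneg : ∀ j → 0ℝ ≤ v o j
      rigidP   : ∀ i j → i ⟷[ μ o ] j → kindP i ≡ rigid →
                 u o i ≈ β i j × (kindQ j ≡ flexible → γ i j ≤ v o j)
      rigidQ   : ∀ i j → i ⟷[ μ o ] j → kindQ j ≡ rigid →
                 v o j ≈ γ i j × (kindP i ≡ flexible → β i j ≤ u o i)
      total    : sum (u o) + sum (v o) ≈ totalShare (μ o)

  record Stable (o : Outcome n) : Set where
    field
      feasible       : Feasible o
      flexible-pairs : ∀ i j → FlexiblePair i j → α i j ≤ u o i + v o j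
      rigid-pairs    : ∀ i j → RigidPair i j → β i j ≤ u o i ⊎ γ i j ≤ v o j

  -- An unmatched agent counts as matched to a rigid dummy outside the
  -- coalition, so it imposes no condition on forcedness.

  Forced : Coalition n → Matching n → Set
  Forced C μ = ∀ i j → i ⟷[ μ ] j →
    (i ∈ inP C × j ∉ inQ C) ⊎ (i ∉ inP C × j ∈ inQ C) → RigidPair i j

  -- An unmatched agent contributes its reservation price, which is 0: this is
  -- the normalisation expressed by u-nonneg, v-nonneg and total above.

  forcedPayoff : Coalition n → Matching n → ℝ
  forcedPayoff C μ =
      sum (λ i → if Vec.lookup (inP C) i
                 then maybe′ (λ j → β i j) 0ℝ (partnerP μ i) else 0ℝ)
    + sum (λ j → if Vec.lookup (inQ C) j
                 then maybe′ (λ i → γ i j) 0ℝ (partnerQ μ j) else 0ℝ)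

  -- Coalitions are nonempty here: the empty one is always forced, and would
  -- otherwise be the only minimal one.

  ForcedUnderBoth : Matching n → Matching n → Coalition n → Set
  ForcedUnderBoth μ μ′ C = NonemptyCoalition C × Forced C μ × Forced C μ′

  MinimalForced : Matching n → Matching n → Coalition n → Set
  MinimalForced μ μ′ C = ForcedUnderBoth μ μ′ C ×
    (∀ D → ForcedUnderBoth μ μ′ D → D ⊆ᶜ C → C ⊆ᶜ D)

  NonDegenerate : Set
  NonDegenerate = ∀ μ μ′ C → MinimalForced μ μ′ C →
    forcedPayoff C μ ≈ forcedPayoff C μ′ → CoincideOn C μ μ′

  StableOutcome : Set
  StableOutcome = Σ (Outcome n) Stable

  infix 4 _≈ₒ_ _≥P_ _≤P_

  -- Equality of outcomes: the same payoffs and the same matching (partnerP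
  -- determines partnerQ).

  _≈ₒ_ : StableOutcome → StableOutcome → Set
  (o , _) ≈ₒ (o′ , _) =
      (∀ i → u o i ≈ u o′ i) × (∀ j → v o j ≈ v o′ j)
    × (∀ i → partnerP (μ o) i ≡ partnerP (μ o′) i)

  _≥P_ : StableOutcome → StableOutcome → Set
  (o , _) ≥P (o′ , _) = (∀ i → u o′ i ≤ u o i) × (∀ j → v o j ≤ v o′ j)

  _≤P_ : StableOutcome → StableOutcome → Set
  s ≤P t = t ≥P s

{-# OPTIONS --safe #-}

-- Given stable outcomes o and o′, let f send a P-agent to its partner under μ
-- and a Q-agent to its partner under μ′, and let the gain of an agent be
-- u − u′ on P and v′ − v on Q.  Stability makes the gain nondecreasing along
-- flexible f-edges, and nonnegative after a rigid edge that starts at a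
-- positive gain.  Let T be the set of agents with nonnegative gain from which
-- flexible f-edges lead to a positive gain.  Then f is defined on T and maps T
-- to itself: the only danger is a rigid edge into a flexible component of gain
-- zero, but such a component is a minimal forced coalition with equal forced
-- payoffs, on which μ and μ′ coincide by non-degeneracy.  As f is injective
-- and T finite, f permutes T, so μ and μ′ both match T ∩ P with T ∩ Q.  Hence
-- o can be used on T and o′ off T, giving the join, or the other way round,
-- giving the meet.

module Submission where

open import Defs
open import Algebra.Bundles using (CommutativeMonoid)
import Algebra.Properties.CommutativeMonoid.Sum
open import Algebra.Structures using (IsCommutativeMonoid)
open import Axiom.ExcludedMiddle using (ExcludedMiddle)
open import Data.Bool using (Bool; true; false; if_then_else_)
open import Data.Fin as Fin using (Fin; zero; suc; punchIn)
import Data.Fin.Properties as Fin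
open import Data.Fin.Subset using (Subset; _∈_; _∉_)
open import Data.Fin.Subset.Properties using (_∈?_)
open import Data.Maybe using (Maybe; just; nothing; maybe; maybe′)
open import Data.Maybe.Properties using (≡-dec; just-injective)
open import Data.Nat as ℕ using (ℕ; suc)
import Data.Nat.Properties as ℕ
open import Data.Product using (∃; ∃₂; _×_; _,_; proj₁; proj₂)
open import Data.Rational as ℚ using (ℚ; 0ℚ; ½)
import Data.Rational.Properties as ℚ
open import Data.Rational.Solver using (module +-*-Solver)
open import Data.Sum as Sum using (_⊎_; inj₁; inj₂; [_,_]; [_,_]′)
open import Data.Unit using (⊤; tt)
import Data.Vec as Vec
open import Data.Vec.Functional using (Vector)
open import Data.Vec.Properties using ([]=⇒lookup; lookup⇒[]=; lookup∘tabulate)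
open import Function.Base using (_∘_)
open import Function.Bundles using (mk⇔)
open import Level using (0ℓ)
open import Relation.Binary.Construct.Closure.Equivalence using (EqClosure; symmetric)
open import Relation.Binary.Construct.Closure.ReflexiveTransitive as Star
  using (Star; _◅_; _◅◅_)
open import Relation.Binary.Construct.Closure.Symmetric using (fwd; bwd)
open import Relation.Binary.Construct.Union using (_∪_)
open import Relation.Binary.Lattice.Structures using (IsLattice)
open import Relation.Binary.PropositionalEquality as ≡
  using (_≡_; _≢_; refl; cong; subst; subst₂)
import Relation.Binary.Reasoning.Setoid
open import Relation.Binary.Structures using (IsEquivalence; IsTotalOrder)
open import Relation.Nullary using (¬_; yes; no; does; contradiction)
open import Relation.Nullary.Decidable using (dec-true; dec-false; does-⇔)

-- Sums and gains are treated over this structure, with ℝ as the instance. Cancellation in the order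
-- takes the place of subtraction.
record OrderedCommutativeMonoid : Set₁ where
  infix  4 _≋_ _≼_
  infixl 6 _⊕_
  field
    Carrier             : Set
    _≋_ _≼_             : Carrier → Carrier → Set
    _⊕_                 : Carrier → Carrier → Carrier
    0#                  : Carrier
    isCommutativeMonoid : IsCommutativeMonoid _≋_ _⊕_ 0#
    isTotalOrder        : IsTotalOrder _≋_ _≼_
    ⊕-mono-≼            : ∀ {a b c d} → a ≼ b → c ≼ d → a ⊕ c ≼ b ⊕ d
    ⊕-cancelˡ-≼         : ∀ a {b c} → a ⊕ b ≼ a ⊕ c → b ≼ c

-- The real numbers

Eventually : (ℕ → Set) → Set
Eventually P = ∃ λ N → ∀ n → N ℕ.≤ n → P n

Eventually-zip : ∀ {P Q R : ℕ → Set} → (∀ n → P n → Q n → R n) →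
       Eventually P → Eventually Q → Eventually R
Eventually-zip f (M , p) (N , q) = M ℕ.⊔ N , λ n n≥ →
  f n (p n (ℕ.≤-trans (ℕ.m≤m⊔n M N) n≥)) (q n (ℕ.≤-trans (ℕ.m≤n⊔m M N) n≥))

p≤∣p∣ : ∀ p → p ℚ.≤ ℚ.∣ p ∣
p≤∣p∣ p with ℚ.≤-total 0ℚ p
... | inj₁ 0≤p = ℚ.≤-reflexive (≡.sym (ℚ.0≤p⇒∣p∣≡p 0≤p))
... | inj₂ p≤0 = ℚ.≤-trans p≤0 (ℚ.0≤∣p∣ p)

∣-∣-swap : ∀ p q → ℚ.∣ p ℚ.- q ∣ ≡ ℚ.∣ q ℚ.- p ∣
∣-∣-swap p q = ≡.trans (≡.sym (ℚ.∣-p∣≡∣p∣ (p ℚ.- q)))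
  (cong ℚ.∣_∣ (solve 2 (λ p q → :- (p :- q) := q :- p) refl p q))
  where open +-*-Solver

∣p-q∣<ε⇒p<q+ε : ∀ p q {ε} → ℚ.∣ p ℚ.- q ∣ ℚ.< ε → p ℚ.< q ℚ.+ ε
∣p-q∣<ε⇒p<q+ε p q {ε} d<ε = subst (ℚ._< q ℚ.+ ε)
  (solve 2 (λ p q → q :+ (p :- q) := p) refl p q)
  (ℚ.+-monoʳ-< q (ℚ.≤-<-trans (p≤∣p∣ (p ℚ.- q)) d<ε))
  where open +-*-Solver

p<q+ε⇒p-q<ε : ∀ p q {ε} → p ℚ.< q ℚ.+ ε → p ℚ.- q ℚ.< ε
p<q+ε⇒p-q<ε p q {ε} h = subst (p ℚ.- q ℚ.<_)
  (solve 2 (λ q ε → q :+ ε :- q := ε) refl q ε)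
  (ℚ.+-monoˡ-< (ℚ.- q) h)
  where open +-*-Solver

within : ∀ p q {ε} → p ℚ.< q ℚ.+ ε → q ℚ.< p ℚ.+ ε → ℚ.∣ p ℚ.- q ∣ ℚ.< ε
within p q {ε} h k with ℚ.∣p∣≡p∨∣p∣≡-p (p ℚ.- q)
... | inj₁ e = subst (ℚ._< ε) (≡.sym e) (p<q+ε⇒p-q<ε p q h)
... | inj₂ e = subst (ℚ._< ε)
  (≡.trans (solve 2 (λ p q → q :- p := :- (p :- q)) refl p q) (≡.sym e))
  (p<q+ε⇒p-q<ε q p k)
  where open +-*-Solver

≈⇒≤ : ∀ x y → x ≈ y → x ≤ y
≈⇒≤ x y x≈y ε ε>0 with x≈y ε ε>0
... | N , h = N , λ n n≥ → ∣p-q∣<ε⇒p<q+ε (seq x n) (seq y n) (h n n≥)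

≈⇒≥ : ∀ x y → x ≈ y → y ≤ x
≈⇒≥ x y x≈y ε ε>0 with x≈y ε ε>0
... | N , h = N , λ n n≥ → ∣p-q∣<ε⇒p<q+ε (seq y n) (seq x n)
  (subst (ℚ._< ε) (∣-∣-swap (seq x n) (seq y n)) (h n n≥))

≤-antisym : ∀ x y → x ≤ y → y ≤ x → x ≈ y
≤-antisym x y x≤y y≤x ε ε>0 =
  Eventually-zip (λ n → within (seq x n) (seq y n)) (x≤y ε ε>0) (y≤x ε ε>0)

≤-reflexive-seq : ∀ x y → (∀ n → seq x n ≡ seq y n) → x ≤ y
≤-reflexive-seq x y e ε ε>0 = 0 , λ n _ →
  subst (ℚ._< seq y n ℚ.+ ε) (≡.trans (ℚ.+-identityʳ _) (≡.sym (e n)))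
    (ℚ.+-monoʳ-< (seq y n) ε>0)

-- Carries the monoid laws over from ℚ, where they hold at every index.
≈-reflexive-seq : ∀ x y → (∀ n → seq x n ≡ seq y n) → x ≈ y
≈-reflexive-seq x y e = ≤-antisym x y
  (≤-reflexive-seq x y e) (≤-reflexive-seq y x λ n → ≡.sym (e n))

≤-trans : ∀ x y z → x ≤ y → y ≤ z → x ≤ z
≤-trans x y z x≤y y≤z ε ε>0 =
  Eventually-zip (λ n h k → ℚ.<-trans h (subst (seq y n ℚ.+ ½ ℚ.* ε ℚ.<_)
      (≡.trans (ℚ.+-assoc (seq z n) _ _) (cong (seq z n ℚ.+_) (half+half ε)))
      (ℚ.+-monoˡ-< (½ ℚ.* ε) k)))
    (x≤y (½ ℚ.* ε) (half-positive ε>0)) (y≤z (½ ℚ.* ε) (half-positive ε>0))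

+-mono-≤ : ∀ a b c d → a ≤ b → c ≤ d → a + c ≤ b + d
+-mono-≤ a b c d a≤b c≤d ε ε>0 =
  Eventually-zip (λ n h k → subst (seq a n ℚ.+ seq c n ℚ.<_)
      (≡.trans (solve 3 (λ b d e → (b :+ e) :+ (d :+ e) := b :+ d :+ (e :+ e))
                  refl (seq b n) (seq d n) (½ ℚ.* ε))
               (cong (seq b n ℚ.+ seq d n ℚ.+_) (half+half ε)))
      (ℚ.+-mono-< h k))
    (a≤b (½ ℚ.* ε) (half-positive ε>0)) (c≤d (½ ℚ.* ε) (half-positive ε>0))
  where open +-*-Solver

+-cancelˡ-≤ : ∀ a b c → a + b ≤ a + c → b ≤ c
+-cancelˡ-≤ a b c h ε ε>0 with h ε ε>0
... | N , k = N , λ n n≥ → subst₂ ℚ._<_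
  (solve 2 (λ a b → :- a :+ (a :+ b) := b) refl (seq a n) (seq b n))
  (solve 3 (λ a c e → :- a :+ (a :+ c :+ e) := c :+ e) refl (seq a n) (seq c n) ε)
  (ℚ.+-monoʳ-< (ℚ.- seq a n) (k n n≥))
  where open +-*-Solver

-- Past an index from which both sequences vary by less than ε / 2, a single n
-- with y n + ε ≤ x n keeps x above y for good.
frequently-above⇒≥ : ∀ x y ε → 0ℚ ℚ.< ε →
  (∀ N → ∃ λ n → N ℕ.≤ n × seq y n ℚ.+ ε ℚ.≤ seq x n) → y ≤ x
frequently-above⇒≥ x y ε ε>0 above δ δ>0 =
  let M , hx = cauchy x (½ ℚ.* ε) (half-positive ε>0)
      N , hy = cauchy y (½ ℚ.* ε) (half-positive ε>0)
      n , n≥ , y+ε≤x = above (M ℕ.⊔ N)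
      M≤n = ℕ.≤-trans (ℕ.m≤m⊔n M N) n≥
      N≤n = ℕ.≤-trans (ℕ.m≤n⊔m M N) n≥
  in M ℕ.⊔ N , λ m m≥ →
    let M≤m = ℕ.≤-trans (ℕ.m≤m⊔n M N) m≥
        N≤m = ℕ.≤-trans (ℕ.m≤n⊔m M N) m≥
        y+½ε<y+ε = subst (seq y m ℚ.+ ½ ℚ.* ε ℚ.<_)
          (≡.trans (ℚ.+-assoc (seq y n) _ _) (cong (seq y n ℚ.+_) (half+half ε)))
          (ℚ.+-monoˡ-< (½ ℚ.* ε)
            (∣p-q∣<ε⇒p<q+ε (seq y m) (seq y n) (hy m n N≤m N≤n)))
        x<x+½ε = ∣p-q∣<ε⇒p<q+ε (seq x n) (seq x m) (hx n m M≤n M≤m)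
    in subst (ℚ._< seq x m ℚ.+ δ) (ℚ.+-identityʳ _)
         (ℚ.+-mono-< (cancel (seq y m) (seq x m)
           (ℚ.<-trans y+½ε<y+ε (ℚ.≤-<-trans y+ε≤x x<x+½ε))) δ>0)
  where
  open +-*-Solver
  cancel : ∀ p q → p ℚ.+ ½ ℚ.* ε ℚ.< q ℚ.+ ½ ℚ.* ε → p ℚ.< q
  cancel p q h = subst₂ ℚ._<_ (simplify p) (simplify q)
    (ℚ.+-monoˡ-< (ℚ.- (½ ℚ.* ε)) h)
    where
    simplify : ∀ r → r ℚ.+ ½ ℚ.* ε ℚ.+ ℚ.- (½ ℚ.* ε) ≡ r
    simplify r = solve 2 (λ r e → r :+ e :+ :- e := r) refl r (½ ℚ.* ε)

-- Excluded middle decides whether x exceeds y by some fixed positive ε at arbitrarily late indices.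
-- If so, the Cauchy property keeps x above y; if not, the excess is eventually below every ε.
≤-total : ExcludedMiddle 0ℓ → ∀ x y → x ≤ y ⊎ y ≤ x
≤-total em x y
  with em {∃ λ ε → 0ℚ ℚ.< ε × (∀ N → ∃ λ n → N ℕ.≤ n × seq y n ℚ.+ ε ℚ.≤ seq x n)}
... | yes (ε , ε>0 , above) = inj₂ (frequently-above⇒≥ x y ε ε>0 above)
... | no ¬above = inj₁ x≤y
  where
  x≤y : x ≤ y
  x≤y ε ε>0 with em {∃ λ N → ∀ n → N ℕ.≤ n → seq x n ℚ.< seq y n ℚ.+ ε}
  ... | yes h = h
  ... | no ¬h = contradiction (ε , ε>0 , above) ¬above
    where
    above : ∀ N → ∃ λ n → N ℕ.≤ n × seq y n ℚ.+ ε ℚ.≤ seq x n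
    above N with em {∃ λ n → N ℕ.≤ n × seq y n ℚ.+ ε ℚ.≤ seq x n}
    ... | yes p = p
    ... | no ¬p = contradiction
      (N , λ n n≥ → ℚ.≰⇒> λ h → ¬p (n , n≥ , h)) ¬h

+-cong : ∀ a b c d → a ≈ b → c ≈ d → a + c ≈ b + d
+-cong a b c d a≈b c≈d = ≤-antisym (a + c) (b + d)
  (+-mono-≤ a b c d (≈⇒≤ a b a≈b) (≈⇒≤ c d c≈d))
  (+-mono-≤ b a d c (≈⇒≥ a b a≈b) (≈⇒≥ c d c≈d))

≈-sym : ∀ x y → x ≈ y → y ≈ x
≈-sym x y e = ≤-antisym y x (≈⇒≥ x y e) (≈⇒≤ x y e)

≈-trans : ∀ x y z → x ≈ y → y ≈ z → x ≈ z
≈-trans x y z e f = ≤-antisym x z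
  (≤-trans x y z (≈⇒≤ x y e) (≈⇒≤ y z f))
  (≤-trans z y x (≈⇒≥ y z f) (≈⇒≥ x y e))

ℝ-orderedCommutativeMonoid : ExcludedMiddle 0ℓ → OrderedCommutativeMonoid
ℝ-orderedCommutativeMonoid em = record
  { Carrier = ℝ
  ; _≋_ = _≈_
  ; _≼_ = _≤_
  ; _⊕_ = _+_
  ; 0# = 0ℝ
  ; isCommutativeMonoid = record
    { isMonoid = record
      { isSemigroup = record
        { isMagma = record
          { isEquivalence = ≈-isEquivalence
          ; ∙-cong = λ {a} {b} {c} {d} → +-cong a b c d
          }
        ; assoc = λ x y z → ≈-reflexive-seq (x + y + z) (x + (y + z))
            λ n → ℚ.+-assoc (seq x n) (seq y n) (seq z n)
        }
      ; identity = (λ x → ≈-reflexive-seq (0ℝ + x) x λ n → ℚ.+-identityˡ (seq x n))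
                 , (λ x → ≈-reflexive-seq (x + 0ℝ) x λ n → ℚ.+-identityʳ (seq x n))
      }
    ; comm = λ x y → ≈-reflexive-seq (x + y) (y + x)
        λ n → ℚ.+-comm (seq x n) (seq y n)
    }
  ; isTotalOrder = record
    { isPartialOrder = record
      { isPreorder = record
        { isEquivalence = ≈-isEquivalence
        ; reflexive = λ {x} {y} → ≈⇒≤ x y
        ; trans = λ {x} {y} {z} → ≤-trans x y z
        }
      ; antisym = λ {x} {y} → ≤-antisym x y
      }
    ; total = ≤-total em
    }
  ; ⊕-mono-≼ = λ {a} {b} {c} {d} → +-mono-≤ a b c d
  ; ⊕-cancelˡ-≼ = λ a {b} {c} → +-cancelˡ-≤ a b c
  }
  where
  ≈-isEquivalence : IsEquivalence _≈_
  ≈-isEquivalence = record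
    { refl = λ {x} → ≈-reflexive-seq x x λ _ → refl
    ; sym = λ {x} {y} → ≈-sym x y
    ; trans = λ {x} {y} {z} → ≈-trans x y z
    }

-- Sums over matchings

module Sums (M : OrderedCommutativeMonoid) where
  open OrderedCommutativeMonoid M public

  commutativeMonoid : CommutativeMonoid 0ℓ 0ℓ
  commutativeMonoid = record { isCommutativeMonoid = isCommutativeMonoid }

  open CommutativeMonoid commutativeMonoid public
    using (setoid; identityˡ; identityʳ; assoc; comm)
    renaming (refl to ≋-refl; sym to ≋-sym; trans to ≋-trans; reflexive to ≋-reflexive
             ; ∙-cong to ⊕-cong; ∙-congˡ to ⊕-congˡ; ∙-congʳ to ⊕-congʳ)
  open IsTotalOrder isTotalOrder public
    using ()
    renaming (refl to ≼-refl; reflexive to ≼-reflexive; trans to ≼-trans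
             ; antisym to ≼-antisym; total to ≼-total)
  open Algebra.Properties.CommutativeMonoid.Sum commutativeMonoid public
    renaming (sum to ∑)
  open Relation.Binary.Reasoning.Setoid setoid

  ⋠⇒≽ : ∀ {a b} → ¬ a ≼ b → b ≼ a
  ⋠⇒≽ {a} {b} a⋠b with ≼-total a b
  ... | inj₁ a≼b = contradiction a≼b a⋠b
  ... | inj₂ b≼a = b≼a

  ⊕-cancelʳ-≼ : ∀ a {b c} → b ⊕ a ≼ c ⊕ a → b ≼ c
  ⊕-cancelʳ-≼ a h = ⊕-cancelˡ-≼ a
    (≼-trans (≼-reflexive (comm a _)) (≼-trans h (≼-reflexive (comm _ a))))

  -- The first hypothesis is a - c ≼ d - b written without subtraction. Here the right difference is
  -- nonpositive, hence so is the left; in `⊕-tightʳ` the left one is nonnegative, hence so is the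
  -- right.
  ⊕-tightˡ : ∀ {a b c d} → a ⊕ b ≼ c ⊕ d → d ≼ b → a ≼ c
  ⊕-tightˡ {a} {b} {c} h d≼b =
    ⊕-cancelʳ-≼ b (≼-trans h (⊕-mono-≼ (≼-refl {c}) d≼b))

  ⊕-tightʳ : ∀ {a b c d} → a ⊕ b ≼ c ⊕ d → c ≼ a → b ≼ d
  ⊕-tightʳ {a} {b} {c} {d} h c≼a =
    ⊕-cancelˡ-≼ a (≼-trans h (⊕-mono-≼ c≼a (≼-refl {d})))

  ∑-mono-≼ : ∀ {n} {f g : Vector Carrier n} → (∀ i → f i ≼ g i) → ∑ f ≼ ∑ g
  ∑-mono-≼ {ℕ.zero} h = ≼-refl
  ∑-mono-≼ {suc n} h = ⊕-mono-≼ (h zero) (∑-mono-≼ (h ∘ suc))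

  -- The totals leave no slack: as the tails are ordered, the heads must be tight, and as the heads
  -- are ordered, so must the tails.
  ∑-tight : ∀ {n} {f g : Vector Carrier n} → (∀ i → f i ≼ g i) →
            ∑ g ≼ ∑ f → ∀ i → g i ≼ f i
  ∑-tight h k zero = ⊕-tightˡ k (∑-mono-≼ (h ∘ suc))
  ∑-tight h k (suc i) = ∑-tight (h ∘ suc) (⊕-tightʳ k (h zero)) i

  ∑-zero : ∀ {n} {f : Vector Carrier n} → (∀ i → f i ≋ 0#) → ∑ f ≋ 0#
  ∑-zero {n} h = ≋-trans (sum-cong-≋ h) (sum-replicate-zero n)

  private
    -- The value a times the indicator that m is j. It spreads the value at a partner over all
    -- candidates, so that the order of summation can be exchanged.
    pick : ∀ {n} → Maybe (Fin n) → Fin n → Carrier → Carrier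
    pick m j a = if does (≡-dec Fin._≟_ m (just j)) then a else 0#

    pick-≡ : ∀ {n} (k : Fin n) a → pick (just k) k a ≋ a
    pick-≡ k a rewrite dec-true (≡-dec Fin._≟_ (just k) (just k)) refl = ≋-refl

    pick-≢ : ∀ {n} m (k : Fin n) a → m ≢ just k → pick m k a ≋ 0#
    pick-≢ m k a m≢k rewrite dec-false (≡-dec Fin._≟_ m (just k)) m≢k = ≋-refl

    ∑-pick : ∀ {n} m (f : Vector Carrier n) → maybe′ f 0# m ≋ ∑ λ j → pick m j (f j)
    ∑-pick {n} nothing f = ≋-sym (∑-zero {n} λ _ → ≋-refl)
    ∑-pick {suc n} (just k) f = ≋-sym (begin
      ∑ (λ j → pick (just k) j (f j))
        ≈⟨ sum-remove {i = k} (λ j → pick (just k) j (f j)) ⟩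
      pick (just k) k (f k) ⊕ ∑ (λ j → pick (just k) (punchIn k j) (f (punchIn k j)))
        ≈⟨ ⊕-cong (pick-≡ k (f k)) (∑-zero λ j → pick-≢ (just k) (punchIn k j) _
             λ e → Fin.punchInᵢ≢i k j (≡.sym (just-injective e))) ⟩
      f k ⊕ 0#
        ≈⟨ identityʳ (f k) ⟩
      f k ∎)

  module _ {n} (μ : Matching n) where

    -- Double counting: both sides run over the matched pairs, and the two indicators agree because
    -- the partner functions are mutually inverse.
    ∑-partner : (f : Fin n → Fin n → Carrier) →
      (∑ λ i → maybe′ (λ j → f i j) 0# (partnerP μ i)) ≋
      (∑ λ j → maybe′ (λ i → f i j) 0# (partnerQ μ j))
    ∑-partner f = begin
      ∑ (λ i → maybe′ (λ j → f i j) 0# (partnerP μ i))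
        ≈⟨ sum-cong-≋ (λ i → ∑-pick (partnerP μ i) (f i)) ⟩
      ∑ (λ i → ∑ λ j → pick (partnerP μ i) j (f i j))
        ≈⟨ ∑-comm (λ i j → pick (partnerP μ i) j (f i j)) ⟩
      ∑ (λ j → ∑ λ i → pick (partnerP μ i) j (f i j))
        ≡⟨ sum-cong-≗ (λ j → sum-cong-≗ λ i → cong (if_then f i j else 0#)
             (does-⇔ (mk⇔ (P⇒Q μ) (Q⇒P μ)) (≡-dec Fin._≟_ (partnerP μ i) (just j))
                                           (≡-dec Fin._≟_ (partnerQ μ j) (just i)))) ⟩
      ∑ (λ j → ∑ λ i → pick (partnerQ μ j) i (f i j))
        ≈⟨ sum-cong-≋ (λ j → ∑-pick (partnerQ μ j) (λ i → f i j)) ⟨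
      ∑ (λ j → maybe′ (λ i → f i j) 0# (partnerQ μ j)) ∎

    module _ (x y : Vector Carrier n) where

      -- Only the sums over each pair have to agree, so the shares b are first moved to P and
      -- compared pair by pair, and y is then moved back to Q.
      ∑-matched : (a b : Fin n → Fin n → Carrier) →
        (∀ i → partnerP μ i ≡ nothing → x i ≋ 0#) →
        (∀ j → partnerQ μ j ≡ nothing → y j ≋ 0#) →
        (∀ i j → partnerP μ i ≡ just j → a i j ⊕ b i j ≋ x i ⊕ y j) →
        (∑ λ i → maybe′ (λ j → a i j) 0# (partnerP μ i)) ⊕
        (∑ λ j → maybe′ (λ i → b i j) 0# (partnerQ μ j)) ≋ ∑ x ⊕ ∑ y
      ∑-matched a b x0 y0 pair = begin
        ∑ (λ i → maybe′ (λ j → a i j) 0# (partnerP μ i)) ⊕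
        ∑ (λ j → maybe′ (λ i → b i j) 0# (partnerQ μ j))
          ≈⟨ ⊕-congˡ (∑-partner b) ⟨
        ∑ (λ i → maybe′ (λ j → a i j) 0# (partnerP μ i)) ⊕
        ∑ (λ i → maybe′ (λ j → b i j) 0# (partnerP μ i))
          ≈⟨ ∑-distrib-+ {n} _ _ ⟨
        ∑ (λ i → maybe′ (λ j → a i j) 0# (partnerP μ i) ⊕
                 maybe′ (λ j → b i j) 0# (partnerP μ i))
          ≈⟨ sum-cong-≋ rows ⟩
        ∑ (λ i → x i ⊕ maybe′ (λ j → y j) 0# (partnerP μ i))
          ≈⟨ ∑-distrib-+ {n} _ _ ⟩
        ∑ x ⊕ ∑ (λ i → maybe′ (λ j → y j) 0# (partnerP μ i))
          ≈⟨ ⊕-congˡ (∑-partner λ _ j → y j) ⟩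
        ∑ x ⊕ ∑ (λ j → maybe′ (λ i → y j) 0# (partnerQ μ j))
          ≈⟨ ⊕-congˡ (sum-cong-≋ column) ⟩
        ∑ x ⊕ ∑ y ∎
        where
        rows : ∀ i → maybe′ (λ j → a i j) 0# (partnerP μ i) ⊕
                     maybe′ (λ j → b i j) 0# (partnerP μ i) ≋
                     x i ⊕ maybe′ (λ j → y j) 0# (partnerP μ i)
        rows i with partnerP μ i in e
        ... | just j  = pair i j e
        ... | nothing = ⊕-congʳ (≋-sym (x0 i e))
        column : ∀ j → maybe′ (λ i → y j) 0# (partnerQ μ j) ≋ y j
        column j with partnerQ μ j in e
        ... | just i  = ≋-refl
        ... | nothing = ≋-sym (y0 j e)

      -- Matched pairs get at least a and the others at least 0, so if all of
      -- them together get exactly the total of a, no inequality is strict.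
      module Tightness (a : Fin n → Fin n → Carrier)
        (x≽0 : ∀ i → 0# ≼ x i) (y≽0 : ∀ j → 0# ≼ y j)
        (pair : ∀ i j → partnerP μ i ≡ just j → a i j ≼ x i ⊕ y j)
        (total : ∑ x ⊕ ∑ y ≋ ∑ λ i → maybe′ (λ j → a i j) 0# (partnerP μ i)) where
        private
          -- `highP` counts a P-agent together with its partner and `highQ` the unmatched Q-agents,
          -- so every payoff occurs once; the lower bounds are `low` and 0.
          low highP highQ : Vector Carrier n
          low i   = maybe′ (λ j → a i j) 0# (partnerP μ i)
          highP i = x i ⊕ maybe′ (λ j → y j) 0# (partnerP μ i)
          highQ j = maybe′ (λ _ → 0#) (y j) (partnerQ μ j)

          low≼highP : ∀ i → low i ≼ highP i
          low≼highP i with partnerP μ i in e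
          ... | just j  = pair i j e
          ... | nothing = ≼-trans (x≽0 i) (≼-reflexive (≋-sym (identityʳ (x i))))

          0≼highQ : ∀ j → 0# ≼ highQ j
          0≼highQ j with partnerQ μ j
          ... | just i  = ≼-refl
          ... | nothing = y≽0 j

          column : ∀ j → maybe′ (λ i → y j) 0# (partnerQ μ j) ⊕ highQ j ≋ y j
          column j with partnerQ μ j
          ... | just i  = identityʳ (y j)
          ... | nothing = identityˡ (y j)

          ∑high≋∑low : ∑ highP ⊕ ∑ highQ ≋ ∑ low ⊕ ∑ {n} (λ _ → 0#)
          ∑high≋∑low = begin
            ∑ highP ⊕ ∑ highQ
              ≈⟨ ⊕-congʳ (∑-distrib-+ {n} x _) ⟩
            ∑ x ⊕ ∑ (λ i → maybe′ (λ j → y j) 0# (partnerP μ i)) ⊕ ∑ highQ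
              ≈⟨ assoc _ _ _ ⟩
            ∑ x ⊕ (∑ (λ i → maybe′ (λ j → y j) 0# (partnerP μ i)) ⊕ ∑ highQ)
              ≈⟨ ⊕-congˡ (⊕-congʳ (∑-partner λ _ j → y j)) ⟩
            ∑ x ⊕ (∑ (λ j → maybe′ (λ i → y j) 0# (partnerQ μ j)) ⊕ ∑ highQ)
              ≈⟨ ⊕-congˡ (∑-distrib-+ {n} _ highQ) ⟨
            ∑ x ⊕ ∑ (λ j → maybe′ (λ i → y j) 0# (partnerQ μ j) ⊕ highQ j)
              ≈⟨ ⊕-congˡ (sum-cong-≋ column) ⟩
            ∑ x ⊕ ∑ y
              ≈⟨ total ⟩
            ∑ low
              ≈⟨ identityʳ _ ⟨
            ∑ low ⊕ 0#
              ≈⟨ ⊕-congˡ (∑-zero {n} λ _ → ≋-refl) ⟨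
            ∑ low ⊕ ∑ {n} (λ _ → 0#) ∎

          highP≼low : ∀ i → highP i ≼ low i
          highP≼low = ∑-tight low≼highP
            (⊕-tightˡ (≼-reflexive ∑high≋∑low) (∑-mono-≼ 0≼highQ))

          highQ≼0 : ∀ j → highQ j ≼ 0#
          highQ≼0 = ∑-tight 0≼highQ
            (⊕-tightʳ (≼-reflexive ∑high≋∑low) (∑-mono-≼ low≼highP))

        matched-≋ : ∀ i j → partnerP μ i ≡ just j → x i ⊕ y j ≋ a i j
        matched-≋ i j e = ≼-antisym (subst
          (λ m → x i ⊕ maybe′ (λ j → y j) 0# m ≼ maybe′ (λ j → a i j) 0# m)
          e (highP≼low i)) (pair i j e)

        unmatchedP-≋ : ∀ i → partnerP μ i ≡ nothing → x i ≋ 0#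
        unmatchedP-≋ i e = ≼-antisym (≼-trans (≼-reflexive (≋-sym (identityʳ (x i)))) (subst
          (λ m → x i ⊕ maybe′ (λ j → y j) 0# m ≼ maybe′ (λ j → a i j) 0# m)
          e (highP≼low i))) (x≽0 i)

        unmatchedQ-≋ : ∀ j → partnerQ μ j ≡ nothing → y j ≋ 0#
        unmatchedQ-≋ j e = ≼-antisym
          (subst (λ m → maybe′ (λ _ → 0#) (y j) m ≼ 0#) e (highQ≼0 j)) (y≽0 j)

-- The orbit of x stays in the finite T, so it returns to x, through a point
-- of T which by injectivity must be y.
module _ {A : Set} {m : ℕ}
  (code : A → Fin m) (code-injective : ∀ {x y} → code x ≡ code y → x ≡ y)
  (_⟶_ : A → A → Set) (⟶-injective : ∀ {x y z} → x ⟶ z → y ⟶ z → x ≡ y)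
  (T : A → Set) (next : ∀ {x} → T x → ∃ λ y → x ⟶ y × T y) where

  private
    orbit : ∀ {x} → T x → ℕ → ∃ T
    orbit t ℕ.zero = _ , t
    orbit t (suc k) = let y , _ , Ty = next (proj₂ (orbit t k)) in y , Ty

    step : ∀ {x} (t : T x) k → proj₁ (orbit t k) ⟶ proj₁ (orbit t (suc k))
    step t k = proj₁ (proj₂ (next (proj₂ (orbit t k))))

    -- The orbit may collide away from its start. Injectivity pulls the collision back step by step
    -- to index 0, where the orbit point just before the later index is a predecessor of x.
    recurs : ∀ {x} (t : T x) k l → k ℕ.< l → proj₁ (orbit t k) ≡ proj₁ (orbit t l) →
             ∃ λ y → T y × y ⟶ x
    recurs t ℕ.zero (suc l) _ e =
      _ , proj₂ (orbit t l) , subst (proj₁ (orbit t l) ⟶_) (≡.sym e) (step t l)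
    recurs t (suc k) (suc l) (ℕ.s≤s k<l) e =
      recurs t k l k<l (⟶-injective (step t k)
        (subst (proj₁ (orbit t l) ⟶_) (≡.sym e) (step t l)))

  finite⇒closed-under-predecessor : ∀ {x y} → T x → y ⟶ x → T y
  finite⇒closed-under-predecessor {x} t y⟶x =
    -- Two of the first m + 1 orbit points share one of the m codes.
    let k , l , k<l , e = Fin.pigeonhole (ℕ.n<1+n m) λ k → code (proj₁ (orbit t (Fin.toℕ k)))
        z , Tz , z⟶x = recurs t (Fin.toℕ k) (Fin.toℕ l) k<l (code-injective e)
    in subst T (⟶-injective z⟶x y⟶x) Tz

-- Agents are points of A.  Along the partial injection x ↦ x's partner, with
-- edges split into flexible (⇝) and rigid (⇢) ones, the gain hi − lo is
-- compared without subtraction.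
module Exchange (em : ExcludedMiddle 0ℓ) (M : OrderedCommutativeMonoid) where
  open Sums M

  module Gains {A : Set} {m : ℕ}
    (code : A → Fin m) (code-injective : ∀ {x y} → code x ≡ code y → x ≡ y)
    (_⇝_ _⇢_ : A → A → Set)
    (functional : ∀ {x y z} → (_⇝_ ∪ _⇢_) x y → (_⇝_ ∪ _⇢_) x z → y ≡ z)
    (injective : ∀ {x y z} → (_⇝_ ∪ _⇢_) x z → (_⇝_ ∪ _⇢_) y z → x ≡ y)
    (exclusive : ∀ {x z} → x ⇢ z → ¬ x ⇝ z)
    (lo hi : A → Carrier)
    (flexible-gain : ∀ {x y} → x ⇝ y → hi x ⊕ lo y ≼ lo x ⊕ hi y)
    (rigid-gain : ∀ {x y} → x ⇢ y → ¬ hi x ≼ lo x → lo y ≼ hi y)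
    (winner-moves : ∀ {x} → ¬ hi x ≼ lo x → ∃ λ y → (_⇝_ ∪ _⇢_) x y)
    (tie-after-rigid : ∀ {x z} → x ⇢ z →
      (∀ y → EqClosure _⇝_ z y → hi y ≋ lo y) → hi x ≼ lo x)
    where

    private
      _⟶_ : A → A → Set
      _⟶_ = _⇝_ ∪ _⇢_

    T : A → Set
    T x = lo x ≼ hi x × ∃ λ y → Star _⇝_ x y × ¬ hi y ≼ lo y

    winner⇒T : ∀ {x} → ¬ hi x ≼ lo x → T x
    winner⇒T w = ⋠⇒≽ w , _ , Star.ε , w

    ¬T⇒≼ : ∀ {x} → ¬ T x → hi x ≼ lo x
    ¬T⇒≼ {x} ¬Tx with em {hi x ≼ lo x}
    ... | yes h = h
    ... | no w  = contradiction (winner⇒T w) ¬Tx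

    private
      gain-⇝ : ∀ {x y} → x ⇝ y → lo x ≼ hi x → lo y ≼ hi y
      gain-⇝ s h = ⊕-tightʳ (flexible-gain s) h

      gain-⇝* : ∀ {x y} → Star _⇝_ x y → lo x ≼ hi x → lo y ≼ hi y
      gain-⇝* Star.ε h = h
      gain-⇝* (s ◅ p) h = gain-⇝* p (gain-⇝ s h)

      last-edge : ∀ {x y} → Star _⇝_ x y → x ≡ y ⊎ ∃ λ w → Star _⇝_ x w × w ⇝ y
      last-edge Star.ε = inj₁ refl
      last-edge (s ◅ p) with last-edge p
      ... | inj₁ refl = inj₂ (_ , Star.ε , s)
      ... | inj₂ (w , q , t) = inj₂ (w , s ◅ q , t)

      -- A step backwards from a point of the path returns, by injectivity, to the preceding point,
      -- and from z there is no such step. So the undirected component is no larger than the forward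
      -- path.
      component-is-path : ∀ {z} → (∀ {w} → ¬ w ⇝ z) →
        ∀ {x y} → Star _⇝_ z x → EqClosure _⇝_ x y → Star _⇝_ z y
      component-is-path start p Star.ε = p
      component-is-path start p (fwd s ◅ q) = component-is-path start (p ◅◅ (s ◅ Star.ε)) q
      component-is-path {z} start p (bwd s ◅ q) with last-edge p
      ... | inj₁ refl = contradiction s start
      ... | inj₂ (w , r , t) =
        component-is-path start (subst (Star _⇝_ z) (injective (inj₁ t) (inj₁ s)) r) q

      T-⇝ : ∀ {x y} → x ⇝ y → T x → T y
      -- If the path to a winner is empty, x wins, and so does y since gains do not fall along
      -- flexible edges; otherwise the path starts with the edge to y.
      T-⇝ s (h , _ , Star.ε , w) = winner⇒T λ k → w (⊕-tightˡ (flexible-gain s) k)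
      T-⇝ s (h , z , t ◅ p , w) with functional (inj₁ s) (inj₁ t)
      ... | refl = gain-⇝ s h , z , p , w

      -- No flexible edge leaves x besides the rigid one, so x itself wins. If y led to no winner,
      -- its whole component would be tied, which `tie-after-rigid` excludes.
      T-⇢ : ∀ {x y} → x ⇢ y → T x → T y
      T-⇢ s (h , z , t ◅ p , w) with functional (inj₂ s) (inj₁ t)
      ... | refl = contradiction t (exclusive s)
      T-⇢ {x} {y} s (h , _ , Star.ε , w) with em {∃ λ z → Star _⇝_ y z × ¬ hi z ≼ lo z}
      ... | yes reach = rigid-gain s w , reach
      ... | no ¬reach = contradiction (tie-after-rigid s tie) w
        where
        start : ∀ {v} → ¬ v ⇝ y
        start t with injective (inj₁ t) (inj₂ s)
        ... | refl = exclusive s t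

        -- The gain is nonnegative at y because x wins, stays so along the path from y, and is
        -- nowhere positive there.
        tie : ∀ z → EqClosure _⇝_ y z → hi z ≋ lo z
        tie z q = ≼-antisym hi≼lo (gain-⇝* p (rigid-gain s w))
          where
          p = component-is-path start Star.ε q
          hi≼lo : hi z ≼ lo z
          hi≼lo with em {hi z ≼ lo z}
          ... | yes k = k
          ... | no ¬k = contradiction (z , p , ¬k) ¬reach

    T-successor : ∀ {x y} → x ⟶ y → T x → T y
    T-successor (inj₁ s) = T-⇝ s
    T-successor (inj₂ s) = T-⇢ s

    private
      T-moves : ∀ {x} → T x → ∃ λ y → x ⟶ y
      T-moves (h , _ , Star.ε , w) = winner-moves w
      T-moves (h , _ , s ◅ p , w) = _ , inj₁ s

    -- Edges map T into itself injectively, so finiteness closes T backwards as well; then no pair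
    -- of either matching is split by T.
    T-predecessor : ∀ {x y} → y ⟶ x → T x → T y
    T-predecessor s t = finite⇒closed-under-predecessor code code-injective _⟶_ injective T
      (λ t → let y , s = T-moves t in y , s , T-successor s t) t s

-- Stable outcomes

module Stability (em : ExcludedMiddle 0ℓ) {n : ℕ} (G : Game n) where
  open Game G
  open Sums (ℝ-orderedCommutativeMonoid em)

  rigid⊎flexible : ∀ i j → RigidPair i j ⊎ FlexiblePair i j
  rigid⊎flexible i j with kindP i | kindQ j
  ... | rigid    | _        = inj₁ (inj₁ refl)
  ... | flexible | rigid    = inj₁ (inj₂ refl)
  ... | flexible | flexible = inj₂ (refl , refl)

  ¬rigid×flexible : ∀ {i j} → RigidPair i j → ¬ FlexiblePair i j
  ¬rigid×flexible (inj₁ r) (f , _) with ≡.trans (≡.sym r) f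
  ... | ()
  ¬rigid×flexible (inj₂ r) (_ , f) with ≡.trans (≡.sym r) f
  ... | ()

  -- Replaces the global equation `total` by conditions on single pairs and unmatched agents, which
  -- survive when parts of two outcomes are put together.
  record Settled (o : Outcome n) : Set where
    field
      matched      : ∀ i j → i ⟷[ μ o ] j → u o i + v o j ≈ α i j
      unmatchedP   : ∀ i → partnerP (μ o) i ≡ nothing → u o i ≈ 0ℝ
      unmatchedQ   : ∀ j → partnerQ (μ o) j ≡ nothing → v o j ≈ 0ℝ
      rigid-shares : ∀ i j → i ⟷[ μ o ] j → RigidPair i j → u o i ≈ β i j × v o j ≈ γ i j

  -- Matched pairs receive at least α, flexible ones by stability and rigid ones by feasibility, so
  -- the equation `total` makes `Tightness` applicable.
  stable⇒settled : ∀ {o} → Stable G o → Settled o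
  stable⇒settled {o} st = record
    { matched      = matched-≋
    ; unmatchedP   = unmatchedP-≋
    ; unmatchedQ   = unmatchedQ-≋
    ; rigid-shares = rigid-shares
    }
    where
    open Stable st
    open Feasible feasible

    shares≤ : ∀ i j → i ⟷[ μ o ] j → RigidPair i j → β i j ≤ u o i × γ i j ≤ v o j
    shares≤ i j e r with kindP i in kP | kindQ j in kQ
    ... | rigid | rigid =
        ≈⇒≥ (u o i) (β i j) (proj₁ (rigidP i j e kP))
      , ≈⇒≥ (v o j) (γ i j) (proj₁ (rigidQ i j e kQ))
    ... | rigid | flexible =
        ≈⇒≥ (u o i) (β i j) (proj₁ (rigidP i j e kP)) , proj₂ (rigidP i j e kP) kQ
    ... | flexible | rigid =
        proj₂ (rigidQ i j e kQ) kP , ≈⇒≥ (v o j) (γ i j) (proj₁ (rigidQ i j e kQ))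
    ... | flexible | flexible with r
    ...   | inj₁ ()
    ...   | inj₂ ()

    pair : ∀ i j → i ⟷[ μ o ] j → α i j ≤ u o i + v o j
    pair i j e with rigid⊎flexible i j
    ... | inj₂ f = flexible-pairs i j f
    ... | inj₁ r = +-mono-≤ (β i j) (u o i) (γ i j) (v o j)
      (proj₁ (shares≤ i j e r)) (proj₂ (shares≤ i j e r))

    open Tightness (μ o) (u o) (v o) α u-nonneg v-nonneg pair total

    -- Both payoffs are bounded below by the prescribed shares and add up to α. This fixes also the
    -- flexible partner of a rigid agent, for whom feasibility gives only an inequality.
    rigid-shares : ∀ i j → i ⟷[ μ o ] j → RigidPair i j → u o i ≈ β i j × v o j ≈ γ i j
    rigid-shares i j e r =
        ≤-antisym (u o i) (β i j)
          (⊕-tightˡ {u o i} {v o j} {β i j} {γ i j} u+v≤α γ≤v) β≤u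
      , ≤-antisym (v o j) (γ i j)
          (⊕-tightʳ {u o i} {v o j} {β i j} {γ i j} u+v≤α β≤u) γ≤v
      where
      β≤u = proj₁ (shares≤ i j e r)
      γ≤v = proj₂ (shares≤ i j e r)
      u+v≤α = ≈⇒≤ (u o i + v o j) (α i j) (matched-≋ i j e)

  payoff : Coalition n → Outcome n → ℝ
  payoff C o = sum (λ i → if Vec.lookup (inP C) i then u o i else 0ℝ)
             + sum (λ j → if Vec.lookup (inQ C) j then v o j else 0ℝ)

  lookup≡false⇒∉ : ∀ {m} {S : Subset m} {i} → Vec.lookup S i ≡ false → i ∉ S
  lookup≡false⇒∉ e i∈S with ≡.trans (≡.sym ([]=⇒lookup i∈S)) e
  ... | ()

  -- Moves the restriction to a coalition inside the pair shares, as `∑-matched` requires.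
  if-maybe : ∀ {m} (b : Bool) (f : Fin m → ℝ) x →
    (if b then maybe′ f 0ℝ x else 0ℝ) ≡ maybe′ (λ j → if b then f j else 0ℝ) 0ℝ x
  if-maybe b f (just _) = refl
  if-maybe true f nothing = refl
  if-maybe false f nothing = refl

  -- In a pair inside C the shares and the payoffs both add up to α. A pair cut by C is rigid, so
  -- its member in C gets exactly the prescribed share.
  forcedPayoff≈payoff : ∀ {o} C → Settled o → Forced G C (μ o) →
    forcedPayoff G C (μ o) ≈ payoff C o
  forcedPayoff≈payoff {o} C se forced =
    subst (_≈ payoff C o) (≡.sym by-pairs) (∑-matched (μ o) x y a b x0 y0 pair)
    where
    open Settled se
    p q : Fin n → Bool
    p i = Vec.lookup (inP C) i
    q j = Vec.lookup (inQ C) j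
    a b : Fin n → Fin n → ℝ
    a i j = if p i then β i j else 0ℝ
    b i j = if q j then γ i j else 0ℝ
    x y : Vector ℝ n
    x i = if p i then u o i else 0ℝ
    y j = if q j then v o j else 0ℝ

    shareP shareQ maskedP maskedQ : Vector ℝ n
    shareP i  = if p i then maybe′ (λ j → β i j) 0ℝ (partnerP (μ o) i) else 0ℝ
    shareQ j  = if q j then maybe′ (λ i → γ i j) 0ℝ (partnerQ (μ o) j) else 0ℝ
    maskedP i = maybe′ (λ j → a i j) 0ℝ (partnerP (μ o) i)
    maskedQ j = maybe′ (λ i → b i j) 0ℝ (partnerQ (μ o) j)

    by-pairs : sum shareP + sum shareQ ≡ sum maskedP + sum maskedQ
    by-pairs = ≡.cong₂ _+_ {sum shareP} {sum maskedP} {sum shareQ} {sum maskedQ}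
      (sum-cong-≗ {n} {shareP} {maskedP} λ i → if-maybe (p i) (λ j → β i j) (partnerP (μ o) i))
      (sum-cong-≗ {n} {shareQ} {maskedQ} λ j → if-maybe (q j) (λ i → γ i j) (partnerQ (μ o) j))

    x0 : ∀ i → partnerP (μ o) i ≡ nothing → x i ≈ 0ℝ
    x0 i e with p i
    ... | true  = unmatchedP i e
    ... | false = ≋-refl {0ℝ}
    y0 : ∀ j → partnerQ (μ o) j ≡ nothing → y j ≈ 0ℝ
    y0 j e with q j
    ... | true  = unmatchedQ j e
    ... | false = ≋-refl {0ℝ}

    pair : ∀ i j → i ⟷[ μ o ] j → a i j + b i j ≈ x i + y j
    pair i j e with p i in i? | q j in j?
    ... | true  | true  = ≈-sym (u o i + v o j) (α i j) (matched i j e)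
    ... | false | false = ≋-refl {0ℝ + 0ℝ}
    ... | true  | false = +-cong (β i j) (u o i) 0ℝ 0ℝ
      (≈-sym (u o i) (β i j) (proj₁ (rigid-shares i j e
        (forced i j e (inj₁ (lookup⇒[]= i (inP C) i? , lookup≡false⇒∉ j?))))))
      (≋-refl {0ℝ})
    ... | false | true  = +-cong 0ℝ 0ℝ (γ i j) (v o j) (≋-refl {0ℝ})
      (≈-sym (v o j) (γ i j) (proj₂ (rigid-shares i j e
        (forced i j e (inj₂ (lookup≡false⇒∉ i? , lookup⇒[]= j (inQ C) j?))))))

  -- Flexible components as minimal forced coalitions

  Agent : Set
  Agent = Fin n ⊎ Fin n

  agent-code : Agent → Fin (n ℕ.+ n)
  agent-code = Fin.join n n

  agent-code-injective : ∀ {x y} → agent-code x ≡ agent-code y → x ≡ y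
  agent-code-injective {x} {y} e = ≡.trans (≡.sym (Fin.splitAt-join n n x))
    (≡.trans (cong (Fin.splitAt n) e) (Fin.splitAt-join n n y))

  member : Coalition n → Agent → Set
  member C = [ _∈ inP C , _∈ inQ C ]

  -- Coalitions are Boolean vectors, so excluded middle decides membership.
  subset : (Fin n → Set) → Subset n
  subset P = Vec.tabulate λ i → does (em {P i})

  ∈-subset⁺ : ∀ {P} i → P i → i ∈ subset P
  ∈-subset⁺ {P} i Pi = lookup⇒[]= i _
    (≡.trans (lookup∘tabulate _ i) (dec-true (em {P i}) Pi))

  ∈-subset⁻ : ∀ {P} i → i ∈ subset P → P i
  ∈-subset⁻ {P} i i∈ with em {P i} in e
  ... | yes Pi = Pi
  ... | no _ with ≡.trans (≡.sym ([]=⇒lookup i∈)) (≡.trans (lookup∘tabulate _ i) (cong does e))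
  ...   | ()

  -- Payoffs of Q are compared the other way round, so following μ from P to Q
  -- and μ′ from Q to P makes both kinds of agents alike.
  data Edge (μ μ′ : Matching n) (R : Fin n → Fin n → Set) : Agent → Agent → Set where
    via  : ∀ {i j} → i ⟷[ μ ] j → R i j → Edge μ μ′ R (inj₁ i) (inj₂ j)
    via′ : ∀ {i j} → i ⟷[ μ′ ] j → R i j → Edge μ μ′ R (inj₂ j) (inj₁ i)

  module _ (μ μ′ : Matching n) where

    Linked : Agent → Agent → Set
    Linked = EqClosure (Edge μ μ′ FlexiblePair)

    component : Agent → Coalition n
    component z = record { inP = subset λ i → Linked z (inj₁ i)
                         ; inQ = subset λ j → Linked z (inj₂ j) }

    member⁺ : ∀ z y → Linked z y → member (component z) y
    member⁺ z (inj₁ i) = ∈-subset⁺ i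
    member⁺ z (inj₂ j) = ∈-subset⁺ j

    member⁻ : ∀ z y → member (component z) y → Linked z y
    member⁻ z (inj₁ i) = ∈-subset⁻ i
    member⁻ z (inj₂ j) = ∈-subset⁻ j

    forced⇒P∈⇒Q∈ : ∀ {D ν i j} → Forced G D ν → i ⟷[ ν ] j → FlexiblePair i j →
      i ∈ inP D → j ∈ inQ D
    forced⇒P∈⇒Q∈ {D} {j = j} forced e f i∈ with j ∈? inQ D
    ... | yes j∈ = j∈
    ... | no j∉ = contradiction f (¬rigid×flexible (forced _ _ e (inj₁ (i∈ , j∉))))

    forced⇒Q∈⇒P∈ : ∀ {D ν i j} → Forced G D ν → i ⟷[ ν ] j → FlexiblePair i j →
      j ∈ inQ D → i ∈ inP D
    forced⇒Q∈⇒P∈ {D} {i = i} forced e f j∈ with i ∈? inP D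
    ... | yes i∈ = i∈
    ... | no i∉ = contradiction f (¬rigid×flexible (forced _ _ e (inj₂ (i∉ , j∈))))

    -- A forced coalition cuts no flexible pair of its matching, so membership spreads along links
    -- in both directions.
    forced⇒closed : ∀ D → Forced G D μ → Forced G D μ′ →
      ∀ {x y} → Linked x y → member D x → member D y
    forced⇒closed D f f′ Star.ε x∈ = x∈
    forced⇒closed D f f′ (fwd (via  e r) ◅ p) x∈ =
      forced⇒closed D f f′ p (forced⇒P∈⇒Q∈ {D} {μ} f e r x∈)
    forced⇒closed D f f′ (fwd (via′ e r) ◅ p) x∈ =
      forced⇒closed D f f′ p (forced⇒Q∈⇒P∈ {D} {μ′} f′ e r x∈)
    forced⇒closed D f f′ (bwd (via  e r) ◅ p) x∈ =
      forced⇒closed D f f′ p (forced⇒Q∈⇒P∈ {D} {μ} f e r x∈)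
    forced⇒closed D f f′ (bwd (via′ e r) ◅ p) x∈ =
      forced⇒closed D f f′ p (forced⇒P∈⇒Q∈ {D} {μ′} f′ e r x∈)

    component-forced : ∀ z ν →
      (∀ {i j} → i ⟷[ ν ] j → FlexiblePair i j →
        Linked (inj₁ i) (inj₂ j) × Linked (inj₂ j) (inj₁ i)) →
      Forced G (component z) ν
    component-forced z ν link i j e cut with rigid⊎flexible i j
    ... | inj₁ r = r
    component-forced z ν link i j e (inj₁ (i∈ , j∉)) | inj₂ f =
      contradiction (member⁺ z (inj₂ j) (member⁻ z (inj₁ i) i∈ ◅◅ proj₁ (link e f))) j∉
    component-forced z ν link i j e (inj₂ (i∉ , j∈)) | inj₂ f =
      contradiction (member⁺ z (inj₁ i) (member⁻ z (inj₂ j) j∈ ◅◅ proj₂ (link e f))) i∉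

    -- A nonempty forced coalition inside the component contains some agent linked to z, hence by
    -- `forced⇒closed` everything linked to z.
    component-minimal : ∀ z → MinimalForced G μ μ′ (component z)
    component-minimal z =
      ( nonempty z
      , component-forced z μ (λ e f → fwd (via e f) ◅ Star.ε , bwd (via e f) ◅ Star.ε)
      , component-forced z μ′ (λ e f → bwd (via′ e f) ◅ Star.ε , fwd (via′ e f) ◅ Star.ε))
      , minimal
      where
      nonempty : ∀ z → NonemptyCoalition (component z)
      nonempty (inj₁ i) = inj₁ (i , member⁺ (inj₁ i) (inj₁ i) Star.ε)
      nonempty (inj₂ j) = inj₂ (j , member⁺ (inj₂ j) (inj₂ j) Star.ε)

      covers : ∀ D → Forced G D μ → Forced G D μ′ → ∀ d → member D d →
        Linked z d → ∀ y → member (component z) y → member D y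
      covers D f f′ d d∈ zd y y∈ =
        forced⇒closed D f f′ (symmetric (Edge μ μ′ FlexiblePair) zd ◅◅ member⁻ z y y∈) d∈

      minimal : ∀ D → ForcedUnderBoth G μ μ′ D → D ⊆ᶜ component z → component z ⊆ᶜ D
      minimal D (inj₁ (i , i∈) , f , f′) (sP , sQ) =
          (λ {k} → covers D f f′ (inj₁ i) i∈ (member⁻ z (inj₁ i) (sP i∈)) (inj₁ k))
        , (λ {k} → covers D f f′ (inj₁ i) i∈ (member⁻ z (inj₁ i) (sP i∈)) (inj₂ k))
      minimal D (inj₂ j∈D , f , f′) (sP , sQ) = let j , j∈ = j∈D in
          (λ {k} → covers D f f′ (inj₂ j) j∈ (member⁻ z (inj₂ j) (sQ j∈)) (inj₁ k))
        , (λ {k} → covers D f f′ (inj₂ j) j∈ (member⁻ z (inj₂ j) (sQ j∈)) (inj₂ k))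

  -- Comparison of two stable outcomes

  module Comparison (nd : NonDegenerate G) {o o′ : Outcome n}
    (st : Stable G o) (st′ : Stable G o′) where

    private
      se  = stable⇒settled st
      se′ = stable⇒settled st′
      module S  = Stable st
      module S′ = Stable st′
      module F  = Feasible S.feasible
      module F′ = Feasible S′.feasible
      module L  = Settled se
      module L′ = Settled se′

    -- `hi` is the payoff in the outcome whose matching provides the outgoing edge of the agent: `o`
    -- on P and `o′` on Q.
    lo hi : Agent → ℝ
    lo = [ u o′ , v o ]′
    hi = [ u o , v o′ ]′

    -- The component is forced under both matchings, so its forced payoffs are its actual payoffs,
    -- which the tie makes equal. Non-degeneracy enters the proof here.
    tie⇒coincide : ∀ z → (∀ y → Linked (μ o) (μ o′) z y → hi y ≈ lo y) →
      CoincideOn (component (μ o) (μ o′) z) (μ o) (μ o′)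
    tie⇒coincide z tie = nd (μ o) (μ o′) C minimal
      (≈-trans (forcedPayoff G C (μ o)) (payoff C o) (forcedPayoff G C (μ o′))
        (forcedPayoff≈payoff C se (proj₁ (proj₂ (proj₁ minimal))))
        (≈-trans (payoff C o) (payoff C o′) (forcedPayoff G C (μ o′))
          same
          (≈-sym (forcedPayoff G C (μ o′)) (payoff C o′)
            (forcedPayoff≈payoff C se′ (proj₂ (proj₂ (proj₁ minimal)))))))
      where
      C = component (μ o) (μ o′) z
      minimal = component-minimal (μ o) (μ o′) z

      x x′ y y′ : Vector ℝ n
      x i  = if Vec.lookup (inP C) i then u o i else 0ℝ
      x′ i = if Vec.lookup (inP C) i then u o′ i else 0ℝ
      y j  = if Vec.lookup (inQ C) j then v o j else 0ℝ
      y′ j = if Vec.lookup (inQ C) j then v o′ j else 0ℝ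

      x≈x′ : ∀ i → x i ≈ x′ i
      x≈x′ i with Vec.lookup (inP C) i in e
      ... | true  = tie (inj₁ i) (member⁻ (μ o) (μ o′) z (inj₁ i) (lookup⇒[]= i (inP C) e))
      ... | false = ≋-refl {0ℝ}

      y≈y′ : ∀ j → y j ≈ y′ j
      y≈y′ j with Vec.lookup (inQ C) j in e
      ... | true  = ≈-sym (v o′ j) (v o j)
        (tie (inj₂ j) (member⁻ (μ o) (μ o′) z (inj₂ j) (lookup⇒[]= j (inQ C) e)))
      ... | false = ≋-refl {0ℝ}

      same : payoff C o ≈ payoff C o′
      same = +-cong (sum x) (sum x′) (sum y) (sum y′)
        (sum-cong-≋ {n} {x} {x′} x≈x′) (sum-cong-≋ {n} {y} {y′} y≈y′)

    private
      _⇝_ _⇢_ _⟶_ : Agent → Agent → Set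
      _⇝_ = Edge (μ o) (μ o′) FlexiblePair
      _⇢_ = Edge (μ o) (μ o′) RigidPair
      x ⟶ y = x ⇝ y ⊎ x ⇢ y

      forget : ∀ {R x y} → Edge (μ o) (μ o′) R x y → Edge (μ o) (μ o′) (λ _ _ → ⊤) x y
      forget (via e _)  = via e tt
      forget (via′ e _) = via′ e tt

      edge-functional : ∀ {R x y z} → Edge (μ o) (μ o′) R x y → Edge (μ o) (μ o′) R x z → y ≡ z
      edge-functional (via e _) (via e′ _) = cong inj₂ (just-injective (≡.trans (≡.sym e) e′))
      edge-functional (via′ e _) (via′ e′ _) =
        cong inj₁ (just-injective (≡.trans (≡.sym (P⇒Q (μ o′) e)) (P⇒Q (μ o′) e′)))

      edge-injective : ∀ {R x y z} → Edge (μ o) (μ o′) R x z → Edge (μ o) (μ o′) R y z → x ≡ y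
      edge-injective (via e _) (via e′ _) =
        cong inj₁ (just-injective (≡.trans (≡.sym (P⇒Q (μ o) e)) (P⇒Q (μ o) e′)))
      edge-injective (via′ e _) (via′ e′ _) = cong inj₂ (just-injective (≡.trans (≡.sym e) e′))

      functional : ∀ {x y z} → x ⟶ y → x ⟶ z → y ≡ z
      functional s t = edge-functional ([ forget , forget ]′ s) ([ forget , forget ]′ t)

      injective : ∀ {x y z} → x ⟶ z → y ⟶ z → x ≡ y
      injective s t = edge-injective ([ forget , forget ]′ s) ([ forget , forget ]′ t)

      exclusive : ∀ {x z} → x ⇢ z → ¬ x ⇝ z
      exclusive (via _ r)  (via _ f)  = ¬rigid×flexible r f
      exclusive (via′ _ r) (via′ _ f) = ¬rigid×flexible r f

      -- The outcome in which the pair is matched gives it exactly α, and stability of the other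
      -- gives it at least α.
      flexible-gain : ∀ {x y} → x ⇝ y → hi x + lo y ≤ lo x + hi y
      flexible-gain (via {i} {j} e f) =
        ≤-trans (u o i + v o j) (α i j) (u o′ i + v o′ j)
          (≈⇒≤ (u o i + v o j) (α i j) (L.matched i j e)) (S′.flexible-pairs i j f)
      flexible-gain (via′ {i} {j} e f) =
        ≤-trans (v o′ j + u o′ i) (u o′ i + v o′ j) (v o j + u o i)
          (≼-reflexive {v o′ j + u o′ i} {u o′ i + v o′ j} (comm (v o′ j) (u o′ i)))
        (≤-trans (u o′ i + v o′ j) (α i j) (v o j + u o i)
          (≈⇒≤ (u o′ i + v o′ j) (α i j) (L′.matched i j e))
        (≤-trans (α i j) (u o i + v o j) (v o j + u o i)
          (S.flexible-pairs i j f)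
          (≼-reflexive {u o i + v o j} {v o j + u o i} (comm (u o i) (v o j)))))

      -- Where the pair is matched both get their prescribed shares. In the other outcome one of
      -- them still gets at least that; it cannot be x, who gets strictly less there.
      rigid-gain : ∀ {x y} → x ⇢ y → ¬ hi x ≤ lo x → lo y ≤ hi y
      rigid-gain (via {i} {j} e r) w = [ lost , kept ]′ (S′.rigid-pairs i j r)
        where
        lost : β i j ≤ u o′ i → v o j ≤ v o′ j
        lost β≤u′ = contradiction (≤-trans (u o i) (β i j) (u o′ i)
          (≈⇒≤ (u o i) (β i j) (proj₁ (L.rigid-shares i j e r))) β≤u′) w
        kept : γ i j ≤ v o′ j → v o j ≤ v o′ j
        kept = ≤-trans (v o j) (γ i j) (v o′ j)
          (≈⇒≤ (v o j) (γ i j) (proj₂ (L.rigid-shares i j e r)))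
      rigid-gain (via′ {i} {j} e r) w = [ kept , lost ]′ (S.rigid-pairs i j r)
        where
        lost : γ i j ≤ v o j → u o′ i ≤ u o i
        lost γ≤v = contradiction (≤-trans (v o′ j) (γ i j) (v o j)
          (≈⇒≤ (v o′ j) (γ i j) (proj₂ (L′.rigid-shares i j e r))) γ≤v) w
        kept : β i j ≤ u o i → u o′ i ≤ u o i
        kept = ≤-trans (u o′ i) (β i j) (u o i)
          (≈⇒≤ (u o′ i) (β i j) (proj₁ (L′.rigid-shares i j e r)))

      edge : ∀ {i j} → i ⟷[ μ o ] j → inj₁ i ⟶ inj₂ j
      edge {i} {j} e = [ (λ r → inj₂ (via e r)) , (λ f → inj₁ (via e f)) ]′ (rigid⊎flexible i j)

      edge′ : ∀ {i j} → i ⟷[ μ o′ ] j → inj₂ j ⟶ inj₁ i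
      edge′ {i} {j} e = [ (λ r → inj₂ (via′ e r)) , (λ f → inj₁ (via′ e f)) ]′ (rigid⊎flexible i j)

      -- Without an outgoing edge `hi` is zero, which cannot exceed the nonnegative `lo`.
      winner-moves : ∀ {x} → ¬ hi x ≤ lo x → ∃ λ y → x ⟶ y
      winner-moves {inj₁ i} w with partnerP (μ o) i in e
      ... | just j  = inj₂ j , edge e
      ... | nothing = contradiction
        (≤-trans (u o i) 0ℝ (u o′ i) (≈⇒≤ (u o i) 0ℝ (L.unmatchedP i e)) (F′.u-nonneg i)) w
      winner-moves {inj₂ j} w with partnerQ (μ o′) j in e
      ... | just i  = inj₁ i , edge′ (Q⇒P (μ o′) e)
      ... | nothing = contradiction
        (≤-trans (v o′ j) 0ℝ (v o j) (≈⇒≤ (v o′ j) 0ℝ (L′.unmatchedQ j e)) (F.v-nonneg j)) w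

      -- The matchings coincide on the tied component, so the rigid pair belongs to both and x gets
      -- the same prescribed share twice.
      tie-after-rigid : ∀ {x z} → x ⇢ z →
        (∀ y → Linked (μ o) (μ o′) z y → hi y ≈ lo y) → hi x ≤ lo x
      tie-after-rigid (via {i} {j} e r) tie = ≤-trans (u o i) (β i j) (u o′ i)
        (≈⇒≤ (u o i) (β i j) (proj₁ (L.rigid-shares i j e r)))
        (≈⇒≥ (u o′ i) (β i j) (proj₁ (L′.rigid-shares i j e′ r)))
        where
        e′ : i ⟷[ μ o′ ] j
        e′ = Q⇒P (μ o′) (≡.trans (≡.sym (proj₂ (tie⇒coincide (inj₂ j) tie) j
          (member⁺ (μ o) (μ o′) (inj₂ j) (inj₂ j) Star.ε))) (P⇒Q (μ o) e))
      tie-after-rigid (via′ {i} {j} e′ r) tie = ≤-trans (v o′ j) (γ i j) (v o j)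
        (≈⇒≤ (v o′ j) (γ i j) (proj₂ (L′.rigid-shares i j e′ r)))
        (≈⇒≥ (v o j) (γ i j) (proj₂ (L.rigid-shares i j e r)))
        where
        e : i ⟷[ μ o ] j
        e = ≡.trans (proj₁ (tie⇒coincide (inj₁ i) tie) i
          (member⁺ (μ o) (μ o′) (inj₁ i) (inj₁ i) Star.ε)) e′

      open Exchange.Gains em (ℝ-orderedCommutativeMonoid em) agent-code agent-code-injective
        _⇝_ _⇢_ functional injective exclusive lo hi
        (λ {x} {y} → flexible-gain {x} {y}) (λ {x} {y} → rigid-gain {x} {y})
        (λ {x} → winner-moves {x}) (λ {x} {z} → tie-after-rigid {x} {z})

    -- On T, P-agents get at least as much in `o` as in `o′` and Q-agents at most as much; off T it
    -- is the reverse.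
    side : Agent → Bool
    side x = does (em {T x})

    side-true : ∀ x → side x ≡ true → lo x ≤ hi x
    side-true x _ with em {T x}
    side-true x _  | yes t = proj₁ t
    side-true x () | no _

    side-false : ∀ x → side x ≡ false → hi x ≤ lo x
    side-false x _ with em {T x}
    side-false x () | yes _
    side-false x _  | no ¬t = ¬T⇒≼ ¬t

    side-μ : ∀ {i j} → i ⟷[ μ o ] j → side (inj₁ i) ≡ side (inj₂ j)
    side-μ e = does-⇔ (mk⇔ (T-successor (edge e)) (T-predecessor (edge e))) em em

    side-μ′ : ∀ {i j} → i ⟷[ μ o′ ] j → side (inj₁ i) ≡ side (inj₂ j)
    side-μ′ e = does-⇔ (mk⇔ (T-predecessor (edge′ e)) (T-successor (edge′ e))) em em

  -- Splicing two outcomes along a set of agents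

  if-elim : ∀ {A : Set} (P : A → Set) b {x y : A} →
    (b ≡ true → P x) → (b ≡ false → P y) → P (if b then x else y)
  if-elim P true  p q = p refl
  if-elim P false p q = q refl

  -- The case analysis for a pair of the spliced matching: `c` and `c′` show that the agent at the
  -- other end selects the same outcome.
  if-elim₂ : ∀ {A B C : Set} (P : B → C → Set) b b′ {m m′ n : A} {x x′ : B} {y y′ : C} →
    (if b then m else m′) ≡ n → (m ≡ n → b ≡ b′) → (m′ ≡ n → b ≡ b′) →
    (m ≡ n → P x y) → (m′ ≡ n → P x′ y′) →
    P (if b then x else x′) (if b′ then y else y′)
  if-elim₂ P true  b′ e c c′ p q with c e
  ... | refl = p e
  if-elim₂ P false b′ e c c′ p q with c′ e
  ... | refl = q e

  module Splice (s : Agent → Bool) (o o′ : Outcome n)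
    (c  : ∀ {i j} → i ⟷[ μ o ] j → s (inj₁ i) ≡ s (inj₂ j))
    (c′ : ∀ {i j} → i ⟷[ μ o′ ] j → s (inj₁ i) ≡ s (inj₂ j)) where

    splice : Outcome n
    splice = record
      { u = λ i → if s (inj₁ i) then u o i else u o′ i
      ; v = λ j → if s (inj₂ j) then v o j else v o′ j
      ; μ = record
        { partnerP = λ i → if s (inj₁ i) then partnerP (μ o) i else partnerP (μ o′) i
        ; partnerQ = λ j → if s (inj₂ j) then partnerQ (μ o) j else partnerQ (μ o′) j
        ; P⇒Q = λ {i} {j} e → if-elim₂ (λ _ m → m ≡ just i)
            (s (inj₁ i)) (s (inj₂ j)) {x = tt} {x′ = tt} e c c′ (P⇒Q (μ o)) (P⇒Q (μ o′))
        ; Q⇒P = λ {i} {j} e → if-elim₂ (λ _ m → m ≡ just j)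
            (s (inj₂ j)) (s (inj₁ i)) {x = tt} {x′ = tt} e
            (λ e → ≡.sym (c (Q⇒P (μ o) e))) (λ e → ≡.sym (c′ (Q⇒P (μ o′) e)))
            (Q⇒P (μ o)) (Q⇒P (μ o′))
        }
      }

    pair-elim : ∀ (R : ℝ → ℝ → Set) {i j} → i ⟷[ μ splice ] j →
      (i ⟷[ μ o ] j → R (u o i) (v o j)) → (i ⟷[ μ o′ ] j → R (u o′ i) (v o′ j)) →
      R (u splice i) (v splice j)
    pair-elim R {i} {j} e = if-elim₂ R (s (inj₁ i)) (s (inj₂ j)) e c c′

    module _ (st : Stable G o) (st′ : Stable G o′)
      (dominates : ∀ i j → (u o i ≤ u splice i × v o j ≤ v splice j)
                         ⊎ (u o′ i ≤ u splice i × v o′ j ≤ v splice j)) where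
      private
        module S  = Stable st
        module S′ = Stable st′
        module F  = Feasible S.feasible
        module F′ = Feasible S′.feasible
        module L  = Settled (stable⇒settled st)
        module L′ = Settled (stable⇒settled st′)

        U V : Vector ℝ n
        U = u splice
        V = v splice

        -- For `∑-matched`, all of α is assigned to the P-agent of a pair and nothing to the
        -- Q-agent.
        no-share : Vector ℝ n
        no-share j = maybe′ (λ _ → 0ℝ) 0ℝ (partnerQ (μ splice) j)

        no-share≈0 : ∀ j → no-share j ≈ 0ℝ
        no-share≈0 j = maybe {B = λ m → maybe′ (λ _ → 0ℝ) 0ℝ m ≈ 0ℝ}
          (λ _ → ≋-refl {0ℝ}) (≋-refl {0ℝ}) (partnerQ (μ splice) j)

        total : sum U + sum V ≈ totalShare G (μ splice)
        total = ≈-sym (totalShare G (μ splice)) (sum U + sum V)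
          (≈-trans (totalShare G (μ splice)) (totalShare G (μ splice) + sum no-share) (sum U + sum V)
            (≈-trans (totalShare G (μ splice)) (totalShare G (μ splice) + 0ℝ)
                     (totalShare G (μ splice) + sum no-share)
              (≈-sym (totalShare G (μ splice) + 0ℝ) (totalShare G (μ splice))
                (identityʳ (totalShare G (μ splice))))
              (+-cong (totalShare G (μ splice)) (totalShare G (μ splice)) 0ℝ (sum no-share)
                (≋-refl {totalShare G (μ splice)})
                (≈-sym (sum no-share) 0ℝ (∑-zero {n} {no-share} no-share≈0))))
            (∑-matched (μ splice) U V α (λ _ _ → 0ℝ)
              (λ i e → if-elim₂ (λ x _ → x ≈ 0ℝ) (s (inj₁ i)) (s (inj₁ i)) {y = tt} {y′ = tt} e
                (λ _ → refl) (λ _ → refl) (L.unmatchedP i) (L′.unmatchedP i))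
              (λ j e → if-elim₂ (λ y _ → y ≈ 0ℝ) (s (inj₂ j)) (s (inj₂ j)) {y = tt} {y′ = tt} e
                (λ _ → refl) (λ _ → refl) (L.unmatchedQ j) (L′.unmatchedQ j))
              (λ i j e → ≈-trans (α i j + 0ℝ) (α i j) (U i + V j) (identityʳ (α i j))
                (≈-sym (U i + V j) (α i j)
                  (pair-elim (λ x y → x + y ≈ α i j) e (L.matched i j) (L′.matched i j))))))

      -- Matched pairs come whole from one outcome, which gives feasibility. Against blocking,
      -- `dominates` gives both agents of any pair at least what one of the stable outcomes gives
      -- them.
      splice-stable : Stable G splice
      splice-stable = record
        { feasible = record
          { u-nonneg = λ i → if-elim (0ℝ ≤_) (s (inj₁ i))
              (λ _ → F.u-nonneg i) (λ _ → F′.u-nonneg i)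
          ; v-nonneg = λ j → if-elim (0ℝ ≤_) (s (inj₂ j))
              (λ _ → F.v-nonneg j) (λ _ → F′.v-nonneg j)
          ; rigidP = λ i j e k → pair-elim
              (λ x y → x ≈ β i j × (kindQ j ≡ flexible → γ i j ≤ y)) e
              (λ e → F.rigidP i j e k) (λ e → F′.rigidP i j e k)
          ; rigidQ = λ i j e k → pair-elim
              (λ x y → y ≈ γ i j × (kindP i ≡ flexible → β i j ≤ x)) e
              (λ e → F.rigidQ i j e k) (λ e → F′.rigidQ i j e k)
          ; total = total
          }
        ; flexible-pairs = λ i j f →
            [ (λ (p , q) → ≤-trans (α i j) (u o i + v o j) (U i + V j) (S.flexible-pairs i j f)
                             (+-mono-≤ (u o i) (U i) (v o j) (V j) p q))
            , (λ (p , q) → ≤-trans (α i j) (u o′ i + v o′ j) (U i + V j) (S′.flexible-pairs i j f)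
                             (+-mono-≤ (u o′ i) (U i) (v o′ j) (V j) p q))
            ]′ (dominates i j)
        ; rigid-pairs = λ i j r →
            [ (λ (p , q) → Sum.map (λ h → ≤-trans (β i j) (u o i) (U i) h p)
                                   (λ h → ≤-trans (γ i j) (v o j) (V j) h q) (S.rigid-pairs i j r))
            , (λ (p , q) → Sum.map (λ h → ≤-trans (β i j) (u o′ i) (U i) h p)
                                   (λ h → ≤-trans (γ i j) (v o′ j) (V j) h q) (S′.rigid-pairs i j r))
            ]′ (dominates i j)
        }

  -- Join and meet

  module Lattice (nd : NonDegenerate G) where

    module _ (x y : StableOutcome G) where
      private
        o  = proj₁ x
        o′ = proj₁ y
        open Comparison nd (proj₂ x) (proj₂ y)
        module ∨ = Splice side o o′ side-μ side-μ′
        module ∧ = Splice side o′ o side-μ′ side-μ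

      join≥ˡ : ∀ i → u o i ≤ u ∨.splice i
      join≥ˡ i = if-elim (u o i ≤_) (side (inj₁ i))
        (λ _ → ≼-refl {u o i}) (side-false (inj₁ i))

      join≥ʳ : ∀ i → u o′ i ≤ u ∨.splice i
      join≥ʳ i = if-elim (u o′ i ≤_) (side (inj₁ i))
        (side-true (inj₁ i)) (λ _ → ≼-refl {u o′ i})

      join≤ˡ : ∀ j → v ∨.splice j ≤ v o j
      join≤ˡ j = if-elim (_≤ v o j) (side (inj₂ j))
        (λ _ → ≼-refl {v o j}) (side-false (inj₂ j))

      join≤ʳ : ∀ j → v ∨.splice j ≤ v o′ j
      join≤ʳ j = if-elim (_≤ v o′ j) (side (inj₂ j))
        (side-true (inj₂ j)) (λ _ → ≼-refl {v o′ j})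

      meet≤ˡ : ∀ i → u ∧.splice i ≤ u o i
      meet≤ˡ i = if-elim (_≤ u o i) (side (inj₁ i))
        (side-true (inj₁ i)) (λ _ → ≼-refl {u o i})

      meet≤ʳ : ∀ i → u ∧.splice i ≤ u o′ i
      meet≤ʳ i = if-elim (_≤ u o′ i) (side (inj₁ i))
        (λ _ → ≼-refl {u o′ i}) (side-false (inj₁ i))

      meet≥ˡ : ∀ j → v o j ≤ v ∧.splice j
      meet≥ˡ j = if-elim (v o j ≤_) (side (inj₂ j))
        (side-true (inj₂ j)) (λ _ → ≼-refl {v o j})

      meet≥ʳ : ∀ j → v o′ j ≤ v ∧.splice j
      meet≥ʳ j = if-elim (v o′ j ≤_) (side (inj₂ j))
        (λ _ → ≼-refl {v o′ j}) (side-false (inj₂ j))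

      join : StableOutcome G
      -- P-agents do at least as well as in both outcomes, so the outcome selected by the Q-agent
      -- serves for the pair; in `meet` the P-agent selects it.
      join = ∨.splice , ∨.splice-stable (proj₂ x) (proj₂ y) λ i j →
        if-elim (λ V → (u o i ≤ u ∨.splice i × v o j ≤ V) ⊎ (u o′ i ≤ u ∨.splice i × v o′ j ≤ V))
          (side (inj₂ j))
          (λ _ → inj₁ (join≥ˡ i , ≼-refl {v o j}))
          (λ _ → inj₂ (join≥ʳ i , ≼-refl {v o′ j}))

      meet : StableOutcome G
      meet = ∧.splice , ∧.splice-stable (proj₂ y) (proj₂ x) λ i j →
        if-elim (λ U → (u o′ i ≤ U × v o′ j ≤ v ∧.splice j) ⊎ (u o i ≤ U × v o j ≤ v ∧.splice j))
          (side (inj₁ i))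
          (λ _ → inj₁ (≼-refl {u o′ i} , meet≥ʳ j))
          (λ _ → inj₂ (≼-refl {u o i} , meet≥ˡ j))

      -- Every payoff in the join is one of x or of y, so common bounds pass to it.
      join-least : ∀ z → _≤P_ G x z → _≤P_ G y z → _≤P_ G join z
      join-least z@(o″ , _) (ux , vx) (uy , vy) =
          (λ i → if-elim (_≤ u o″ i) (side (inj₁ i)) (λ _ → ux i) (λ _ → uy i))
        , (λ j → if-elim (v o″ j ≤_) (side (inj₂ j)) (λ _ → vx j) (λ _ → vy j))

      meet-greatest : ∀ z → _≤P_ G z x → _≤P_ G z y → _≤P_ G z meet
      meet-greatest z@(o″ , _) (ux , vx) (uy , vy) =
          (λ i → if-elim (u o″ i ≤_) (side (inj₁ i)) (λ _ → uy i) (λ _ → ux i))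
        , (λ j → if-elim (_≤ v o″ j) (side (inj₂ j)) (λ _ → vy j) (λ _ → vx j))

      -- Equality of outcomes includes the matchings. Equal payoffs tie every component, so the
      -- matchings coincide on each.
      antisym : _≤P_ G x y → _≤P_ G y x → _≈ₒ_ G x y
      antisym (u≤u′ , v′≤v) (u′≤u , v≤v′) =
        u≈u′ , (λ j → ≈-sym (v o′ j) (v o j) (v′≈v j)) , λ i →
          proj₁ (tie⇒coincide (inj₁ i) (λ z _ → tie z)) i
            (member⁺ (μ o) (μ o′) (inj₁ i) (inj₁ i) Star.ε)
        where
        u≈u′ : ∀ i → u o i ≈ u o′ i
        u≈u′ i = ≤-antisym (u o i) (u o′ i) (u≤u′ i) (u′≤u i)
        v′≈v : ∀ j → v o′ j ≈ v o j
        v′≈v j = ≤-antisym (v o′ j) (v o j) (v′≤v j) (v≤v′ j)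
        tie : ∀ z → hi z ≈ lo z
        tie (inj₁ i) = u≈u′ i
        tie (inj₂ j) = v′≈v j

    isLattice : IsLattice (_≈ₒ_ G) (_≤P_ G) join meet
    isLattice = record
      { isPartialOrder = record
        { isPreorder = record
          { isEquivalence = record
            { refl  = λ {x} → let o = proj₁ x in
                (λ i → ≋-refl {u o i}) , (λ j → ≋-refl {v o j}) , λ _ → refl
            ; sym   = λ {x} {y} (p , q , r) → let o = proj₁ x ; o′ = proj₁ y in
                (λ i → ≈-sym (u o i) (u o′ i) (p i)) , (λ j → ≈-sym (v o j) (v o′ j) (q j))
                , λ i → ≡.sym (r i)
            ; trans = λ {x} {y} {z} (p , q , r) (p′ , q′ , r′) →
                let o = proj₁ x ; o′ = proj₁ y ; o″ = proj₁ z in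
                (λ i → ≈-trans (u o i) (u o′ i) (u o″ i) (p i) (p′ i))
                , (λ j → ≈-trans (v o j) (v o′ j) (v o″ j) (q j) (q′ j))
                , λ i → ≡.trans (r i) (r′ i)
            }
          ; reflexive = λ {x} {y} (p , q , _) → let o = proj₁ x ; o′ = proj₁ y in
              (λ i → ≈⇒≤ (u o i) (u o′ i) (p i)) , λ j → ≈⇒≥ (v o j) (v o′ j) (q j)
          ; trans = λ {x} {y} {z} (p , q) (p′ , q′) →
              let o = proj₁ x ; o′ = proj₁ y ; o″ = proj₁ z in
              (λ i → ≤-trans (u o i) (u o′ i) (u o″ i) (p i) (p′ i))
              , λ j → ≤-trans (v o″ j) (v o′ j) (v o j) (q′ j) (q j)
          }
        ; antisym = λ {x} {y} → antisym x y
        }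
      ; supremum = λ x y → (join≥ˡ x y , join≤ˡ x y) , (join≥ʳ x y , join≤ʳ x y) , join-least x y
      ; infimum  = λ x y → (meet≤ˡ x y , meet≥ˡ x y) , (meet≤ʳ x y , meet≥ʳ x y) , meet-greatest x y
      }

theorem2 : ExcludedMiddle 0ℓ → (n : ℕ) (G : Game n) → NonDegenerate G →
    ∃₂ λ _∨_ _∧_ → IsLattice (_≈ₒ_ G) (_≤P_ G) _∨_ _∧_
theorem2 em n G nd = join , meet , isLattice
  where open Stability.Lattice em G nd
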